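{- Let $\Delta$ be a simplicial complex of dimension $d\ge 1$. (i) If $\Delta$ is pure and very-weakly-chordal, then it is weakly-ridge-chordal. (ii) If $\Delta$ is pure and mid-chordal, then $\Delta$ is weakly-vertex-chordal. (iii) Mid-chordality and ridge-chordality are independent properties, even for pure complexes: there is a pure complex that is mid-chordal but not ridge-chordal, and a pure complex that is ridge-chordal but not mid-chordal. (In particular, pure mid-chordal complexes are not vertex-chordal in general.) The converses of (i) and (ii) are false: there is a pure weakly-ridge-chordal complex that is not very-weakly-chordal, and a pure weakly-vertex-chordal complex that is not mid-chordal.
   Context: Simplicial complexes are finite. A vertex labeling of a complex with $n$ vertices is a bijection of its vertices with $[n]$; $\max F$ is the largest label in $F$; the size of a face is its number of vertices. Two faces of the same dimension $k$ are adjacent if their intersection has dimension $k-1$. $\Delta$ is: - mid-chordal, if it has a labeling such that for every two facets $F\neq G$ with the same size and same maximum, $\Delta$ contains every $2$-element subset $e$ of $(F\cup G)\setminus\{\max F\}$ and, for each such $e$, some face $H_e$ with $|H_e|=|F|$ and $e\subseteq H_e\subseteq (F\cup G)\setminus\{\max F\}$; - very-weakly-chordal, if it has a labeling such that for every two adjacent facets $F\ne G$ with the same size and same maximum, $(F\cup G)\setminus\{\max F\}$ is a face of $\Delta$. A $t$-clique of a complex $\Gamma$ is a set $X$ of vertices such that any $k+1\le t+1$ vertices of $X$ span a $k$-face of $\Gamma$. A face of $\Gamma$ is $t$-simplicial if the vertices of its star in $\Gamma$ form a $t$-clique of $\Gamma$. Deleting above a face $F$ of $\Gamma$ means passing to the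 complex $\operatorname{abdel}(F,\Gamma)$ whose facets are the facets of $\Gamma$ not containing $F$. The empty set has dimension $-1$. For $0\le j<d$, a $d$-dimensional complex $\Delta$ is $j$-face-chordal (resp. weakly-$j$-face-chordal) if it can be reduced to a complex of dimension $\le j$ by repeatedly deleting above a $j$-face that is $d$-simplicial (resp. $1$-simplicial) in the current complex (here $d$ is always the dimension of the original $\Delta$). (Weakly-)vertex-chordal means (weakly-)$0$-face-chordal, and (weakly-)ridge-chordal means (weakly-)$(d-1)$-face-chordal. -}

module Defs where

open import Data.Fin.Base as Fin using (Fin)
open import Data.Fin.Subset
  using (Subset; _∈_; _⊆_; _⊈_; _⊂_; _⊄_; _∪_; _∩_; _-_; ⁅_⁆; ∣_∣; Nonempty; Lift)
open import Data.Fin.Subset.Properties using (_⊆?_; _⊂?_; anySubset?; ⊆-trans)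
open import Data.Nat.Base using (ℕ; suc; pred; _≤_; _<_)
open import Data.Product.Base using (Σ; Σ-syntax; ∃-syntax; _×_; _,_)
open import Data.Refinement.Base using (Refinement-syntax; value)
open import Function.Bundles using (_⤖_; Bijection)
open import Level using (0ℓ)
open import Relation.Binary.Construct.Closure.ReflexiveTransitive using (Star)
open import Relation.Binary.PropositionalEquality.Core using (_≡_; _≢_)
open import Relation.Nullary.Decidable using (map′; _×-dec_; ¬?)
open import Relation.Unary using (Pred; Decidable)

-- The vertices are those x with ⁅ x ⁆ a face; they need not be all of Fin n,
-- as deletions can make vertices disappear.  The void complex (no faces at
-- all, not even the empty one) is allowed: deleting above a face contained in
-- every facet produces it.
record Complex (n : ℕ) : Set₁ where
  field
    Face   : Pred (Subset n) 0ℓ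
    face?  : Decidable Face
    closed : ∀ {σ τ} → σ ⊆ τ → Face τ → Face σ

open Complex public

module _ {n : ℕ} where

  IsVertex : Complex n → Pred (Fin n) 0ℓ
  IsVertex Γ x = Face Γ ⁅ x ⁆

  Vertex : Complex n → Set
  Vertex Γ = [ x ∈ Fin n ∣ IsVertex Γ x ]

  IsFacet : Complex n → Pred (Subset n) 0ℓ
  IsFacet Γ F = Face Γ F × (∀ G → Face Γ G → F ⊄ G)

  isFacet? : (Γ : Complex n) → Decidable (IsFacet Γ)
  isFacet? Γ F = face? Γ F ×-dec
    map′ (λ ¬∃ G G∈Γ F⊂G → ¬∃ (G , G∈Γ , F⊂G))
         (λ max (G , G∈Γ , F⊂G) → max G G∈Γ F⊂G)
         (¬? (anySubset? (λ G → face? Γ G ×-dec F ⊂? G)))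

  Pure : Complex n → Set
  Pure Γ = ∀ F G → IsFacet Γ F → IsFacet Γ G → ∣ F ∣ ≡ ∣ G ∣

  -- A k-face has k + 1 vertices.
  DimensionAtMost : ℕ → Complex n → Set
  DimensionAtMost d Γ = ∀ F → Face Γ F → ∣ F ∣ ≤ suc d

  HasDimension : ℕ → Complex n → Set
  HasDimension d Γ = DimensionAtMost d Γ × ∃[ F ] (Face Γ F × ∣ F ∣ ≡ suc d)

  Adjacent : Subset n → Subset n → Set
  Adjacent F G = ∣ F ∣ ≡ ∣ G ∣ × suc ∣ F ∩ G ∣ ≡ ∣ F ∣

  -- The number m of vertices is determined by the bijection; labels run
  -- through 0 , … , m - 1 instead of 1 , … , m.
  Labeling : Complex n → Set
  Labeling Γ = Σ[ m ∈ ℕ ] (Vertex Γ ⤖ Fin m)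

  label : (Γ : Complex n) (ℓ : Labeling Γ) → Vertex Γ → Fin (Σ.proj₁ ℓ)
  label Γ (_ , b) = Bijection.to b

  -- v is the vertex of F carrying the label max F.
  IsMax : (Γ : Complex n) → Labeling Γ → Subset n → Vertex Γ → Set
  IsMax Γ ℓ F v =
    value v ∈ F × (∀ w → value w ∈ F → label Γ ℓ w Fin.≤ label Γ ℓ v)

  MidChordal : Complex n → Set
  MidChordal Γ = Σ[ ℓ ∈ Labeling Γ ] (∀ F G v →
    IsFacet Γ F → IsFacet Γ G → F ≢ G → ∣ F ∣ ≡ ∣ G ∣ →
    IsMax Γ ℓ F v → IsMax Γ ℓ G v →
    ∀ e → ∣ e ∣ ≡ 2 → e ⊆ (F ∪ G) - value v →
    Face Γ e ×
    ∃[ H ] (Face Γ H × ∣ H ∣ ≡ ∣ F ∣ × e ⊆ H × H ⊆ (F ∪ G) - value v))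

  VeryWeaklyChordal : Complex n → Set
  VeryWeaklyChordal Γ = Σ[ ℓ ∈ Labeling Γ ] (∀ F G v →
    IsFacet Γ F → IsFacet Γ G → F ≢ G → Adjacent F G →
    IsMax Γ ℓ F v → IsMax Γ ℓ G v →
    Face Γ ((F ∪ G) - value v))

  IsClique : ℕ → Complex n → Pred (Fin n) 0ℓ → Set
  IsClique t Γ X =
    (∀ x → X x → IsVertex Γ x) ×
    (∀ Y → Lift X Y → Nonempty Y → ∣ Y ∣ ≤ suc t → Face Γ Y)

  -- The star of F consists of the faces σ of Γ such that F ∪ σ is a face of Γ.
  InStar : Complex n → Subset n → Pred (Subset n) 0ℓ
  InStar Γ F σ = Face Γ (F ∪ σ)

  IsSimplicial : ℕ → Complex n → Subset n → Set
  IsSimplicial t Γ F = Face Γ F × IsClique t Γ (λ x → InStar Γ F ⁅ x ⁆)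

  abdel : Subset n → Complex n → Complex n
  abdel F Γ .Face σ = ∃[ G ] ((IsFacet Γ G × F ⊈ G) × σ ⊆ G)
  abdel F Γ .face? σ =
    anySubset? (λ G → (isFacet? Γ G ×-dec ¬? (F ⊆? G)) ×-dec σ ⊆? G)
  abdel F Γ .closed σ⊆τ (G , G-ok , τ⊆G) = G , G-ok , ⊆-trans σ⊆τ τ⊆G

  data Deletion (t j : ℕ) (Γ : Complex n) : Complex n → Set where
    delete : ∀ F → ∣ F ∣ ≡ suc j → IsSimplicial t Γ F →
             Deletion t j Γ (abdel F Γ)

  ReducibleBy : (t j : ℕ) → Complex n → Set₁
  ReducibleBy t j Γ = ∃[ Γ′ ] (Star (Deletion t j) Γ Γ′ × DimensionAtMost j Γ′)

  FaceChordal : (d j : ℕ) → Complex n → Set₁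
  FaceChordal d j Γ = HasDimension d Γ × j < d × ReducibleBy d j Γ

  WeaklyFaceChordal : (d j : ℕ) → Complex n → Set₁
  WeaklyFaceChordal d j Γ = HasDimension d Γ × j < d × ReducibleBy 1 j Γ

  VertexChordal WeaklyVertexChordal : ℕ → Complex n → Set₁
  VertexChordal       d = FaceChordal d 0
  WeaklyVertexChordal d = WeaklyFaceChordal d 0

  RidgeChordal WeaklyRidgeChordal : ℕ → Complex n → Set₁
  RidgeChordal       d = FaceChordal d (pred d)
  WeaklyRidgeChordal d = WeaklyFaceChordal d (pred d)

{-# OPTIONS --safe #-}

-- For (i) and (ii), treat the vertices in order of decreasing label, deleting
-- above every face R of the required size that contains the current vertex v.
-- Two facets F, G containing R then both have maximum v, and chordality joins
-- any two of their vertices other than v by a facet inside (F ∪ G) - v.  Its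
-- labels are smaller than that of v, so it has not been deleted yet, and R is
-- 1-simplicial.
--
-- For the negative claims, a complex without any d-simplicial j-face cannot be
-- reduced at all, and a complex violating a chordality condition at two facets
-- through each vertex v fails for every labeling, by taking v last.

module Submission where

open import Defs
open import Data.Bool.Properties using () renaming (_≟_ to _≟ᵇ_)
open import Data.Fin.Base as Fin using (Fin; toℕ; fromℕ; fromℕ<)
open import Data.Fin.Patterns using (0F; 1F; 2F; 3F; 4F; 5F)
open import Data.Fin.Properties
  using (toℕ<n; toℕ-injective; toℕ-fromℕ<; ≤fromℕ; all?)
  renaming (_≟_ to _≟ᶠ_; _≤?_ to _≤ᶠ?_)
open import Data.Fin.Subset
  using (Subset; inside; outside; _∈_; _⊆_; _⊈_; _⊂_; _⊄_; _∪_; _∩_; _-_; ⁅_⁆; ∣_∣; Nonempty; Lift)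
open import Data.Fin.Subset.Induction using (⊃-wellFounded)
open import Data.Fin.Subset.Properties
open import Data.Irrelevant using ([_])
open import Data.List.Base using (List; []; _∷_; _++_; map; filter)
import Data.List.Membership.Propositional as List
open import Data.List.Membership.Propositional.Properties
  using (∈-++⁺ˡ; ∈-++⁺ʳ; ∈-map⁺; ∈-filter⁺; ∈-filter⁻)
open import Data.List.Relation.Unary.All as All using (All; []; _∷_)
import Data.List.Relation.Unary.All.Properties as All
open import Data.List.Relation.Unary.Any as Any using (Any; here)
open import Data.Nat.Base using (ℕ; zero; suc; _≤_; _<_; z≤n; s≤s)
import Data.Nat.Properties as ℕ
open import Data.Product.Base using (_×_; _,_; ∃-syntax; Σ-syntax; proj₁; proj₂)
open import Data.Refinement.Base using (value; _,_)
open import Data.Refinement.Properties using (value-injective)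
open import Data.Sum.Base using (inj₁; inj₂; [_,_]′)
open import Data.Vec.Base using (here; _∷_; [])
open import Data.Vec.Properties using (≡-dec)
open import Function.Base using (id; _∘_)
open import Function.Bundles using (Bijection; mk⤖)
open import Induction.WellFounded using (Acc; acc)
open import Relation.Binary.Construct.Closure.ReflexiveTransitive using (Star; ε; _◅_; _◅◅_)
open import Relation.Binary.Definitions using (DecidableEquality)
open import Relation.Binary.PropositionalEquality
  using (_≡_; _≢_; refl; sym; trans; cong; subst)
open import Relation.Nullary.Decidable
  using (Dec; yes; no; _×-dec_; _→-dec_; ¬?; map′; decidable-stable; from-yes)
open import Relation.Nullary.Negation.Core using (¬_; contradiction)

-- Finite subsets and their sizes.

∣p∣≤1+∣p-x∣ : ∀ {n} (p : Subset n) x → ∣ p ∣ ≤ suc ∣ p - x ∣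
∣p∣≤1+∣p-x∣ (inside  ∷ p) Fin.zero = s≤s (ℕ.≤-reflexive (cong ∣_∣ (sym (p─⊥≡p p))))
∣p∣≤1+∣p-x∣ (outside ∷ p) Fin.zero = ℕ.m≤n⇒m≤1+n (ℕ.≤-reflexive (cong ∣_∣ (sym (p─⊥≡p p))))
∣p∣≤1+∣p-x∣ (inside  ∷ p) (Fin.suc x) = s≤s (∣p∣≤1+∣p-x∣ p x)
∣p∣≤1+∣p-x∣ (outside ∷ p) (Fin.suc x) = ∣p∣≤1+∣p-x∣ p x

-- Greedy from the head: an element of `q` outside `p` is dropped whenever the rest of `q` still has
-- `m` elements; otherwise `q` itself has size `m`.
⊆-intermediate : ∀ {n m} {p q : Subset n} → p ⊆ q → ∣ p ∣ ≤ m → m ≤ ∣ q ∣ →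
                 ∃[ r ] (p ⊆ r × r ⊆ q × ∣ r ∣ ≡ m)
⊆-intermediate {p = []} {[]} _ _ z≤n = [] , ⊆-refl , ⊆-refl , refl
⊆-intermediate {p = inside ∷ p} {outside ∷ q} p⊆q _ _ with () ← p⊆q here
⊆-intermediate {p = outside ∷ p} {outside ∷ q} p⊆q lo hi =
  let r , p⊆r , r⊆q , eq = ⊆-intermediate (drop-∷-⊆ p⊆q) lo hi
  in outside ∷ r , s⊆s p⊆r , s⊆s r⊆q , eq
⊆-intermediate {p = inside ∷ p} {inside ∷ q} p⊆q (s≤s lo) (s≤s hi) =
  let r , p⊆r , r⊆q , eq = ⊆-intermediate (drop-∷-⊆ p⊆q) lo hi
  in inside ∷ r , s⊆s p⊆r , s⊆s r⊆q , cong suc eq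
⊆-intermediate {m = m} {outside ∷ p} {inside ∷ q} p⊆q lo hi with m ℕ.≤? ∣ q ∣
... | yes m≤∣q∣ =
  let r , p⊆r , r⊆q , eq = ⊆-intermediate (drop-∷-⊆ p⊆q) lo m≤∣q∣
  in outside ∷ r , s⊆s p⊆r , out⊆ r⊆q , eq
... | no m≰∣q∣ = inside ∷ q , p⊆q , ⊆-refl , ℕ.≤-antisym (ℕ.≰⇒> m≰∣q∣) hi

allSubsets : ∀ n → List (Subset n)
allSubsets zero    = [] ∷ []
allSubsets (suc n) = map (inside ∷_) (allSubsets n) ++ map (outside ∷_) (allSubsets n)

∈-allSubsets : ∀ {n} (p : Subset n) → p List.∈ allSubsets n
∈-allSubsets []            = here refl
∈-allSubsets (inside ∷ p)  = ∈-++⁺ˡ (∈-map⁺ (inside ∷_) (∈-allSubsets p))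
∈-allSubsets (outside ∷ p) = ∈-++⁺ʳ _ (∈-map⁺ (outside ∷_) (∈-allSubsets p))

module _ {n : ℕ} where

  infix 4 _≟ˢ_
  _≟ˢ_ : DecidableEquality (Subset n)
  _≟ˢ_ = ≡-dec _≟ᵇ_

  ⊆∧⊄⇒≡ : {p q : Subset n} → p ⊆ q → p ⊄ q → p ≡ q
  ⊆∧⊄⇒≡ {p} {q} p⊆q p⊄q = ⊆-antisym p⊆q q⊆p
    where
    q⊆p : q ⊆ p
    q⊆p {x} x∈q with x ∈? p
    ... | yes x∈p = x∈p
    ... | no  x∉p = contradiction ((λ {y} → p⊆q {y}) , x , x∈q , x∉p) p⊄q

  ⊆∧∣∣≥⇒≡ : {p q : Subset n} → p ⊆ q → ∣ q ∣ ≤ ∣ p ∣ → p ≡ q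
  ⊆∧∣∣≥⇒≡ p⊆q ∣q∣≤∣p∣ = ⊆∧⊄⇒≡ p⊆q (λ p⊂q → ℕ.<⇒≱ (p⊂q⇒∣p∣<∣q∣ p⊂q) ∣q∣≤∣p∣)

  ⊈⇒∣∩∣<∣∣ : {p q : Subset n} → p ⊈ q → ∣ p ∩ q ∣ < ∣ p ∣
  ⊈⇒∣∩∣<∣∣ {p} {q} p⊈q = ℕ.≰⇒> λ ∣p∣≤∣p∩q∣ →
    p⊈q (⊆-trans (⊆-reflexive (sym (⊆∧∣∣≥⇒≡ (p∩q⊆p p q) ∣p∣≤∣p∩q∣))) (p∩q⊆q p q))

  ⊈⇒∣∣<∣∪∣ : {p q : Subset n} → q ⊈ p → ∣ p ∣ < ∣ p ∪ q ∣
  ⊈⇒∣∣<∣∪∣ {p} {q} q⊈p = ℕ.≰⇒> λ ∣p∪q∣≤∣p∣ →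
    q⊈p (⊆-trans (q⊆p∪q p q) (⊆-reflexive (sym (⊆∧∣∣≥⇒≡ (p⊆p∪q q) ∣p∪q∣≤∣p∣))))

  -- Removing `x` a second time changes nothing, whereas removing a member gives a strictly smaller
  -- set.
  x∉p-x : (p : Subset n) (x : Fin n) → ¬ (x ∈ p - x)
  x∉p-x p x x∈p-x = ⊂-irref (p─q─q≡p─q p ⁅ x ⁆) (x∈p⇒p-x⊂p x∈p-x)

  ∪-lub : {p q r : Subset n} → p ⊆ r → q ⊆ r → p ∪ q ⊆ r
  ∪-lub {p} {q} p⊆r q⊆r x∈p∪q = [ p⊆r , q⊆r ]′ (x∈p∪q⁻ p q x∈p∪q)

  x∈p⇒⁅x⁆⊆p : {p : Subset n} {x : Fin n} → x ∈ p → ⁅ x ⁆ ⊆ p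
  x∈p⇒⁅x⁆⊆p {p} {x} x∈p y∈⁅x⁆ = subst (_∈ p) (sym (x∈⁅y⁆⇒x≡y x y∈⁅x⁆)) x∈p

  ⁅x⁆∪⁅y⁆⊆p : {p : Subset n} {x y : Fin n} → x ∈ p → y ∈ p → ⁅ x ⁆ ∪ ⁅ y ⁆ ⊆ p
  ⁅x⁆∪⁅y⁆⊆p x∈p y∈p = ∪-lub (x∈p⇒⁅x⁆⊆p x∈p) (x∈p⇒⁅x⁆⊆p y∈p)

  x∈⁅x⁆∪⁅y⁆ : (x y : Fin n) → x ∈ ⁅ x ⁆ ∪ ⁅ y ⁆
  x∈⁅x⁆∪⁅y⁆ x y = x∈p∪q⁺ (inj₁ (x∈⁅x⁆ x))

  y∈⁅x⁆∪⁅y⁆ : (x y : Fin n) → y ∈ ⁅ x ⁆ ∪ ⁅ y ⁆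
  y∈⁅x⁆∪⁅y⁆ x y = x∈p∪q⁺ {p = ⁅ x ⁆} (inj₂ (x∈⁅x⁆ y))

  ∣⁅x⁆∪⁅y⁆∣≡2 : {x y : Fin n} → x ≢ y → ∣ ⁅ x ⁆ ∪ ⁅ y ⁆ ∣ ≡ 2
  ∣⁅x⁆∪⁅y⁆∣≡2 {x} {y} x≢y = ℕ.≤-antisym upper lower
    where
    e = ⁅ x ⁆ ∪ ⁅ y ⁆

    e-x⊆⁅y⁆ : e - x ⊆ ⁅ y ⁆
    e-x⊆⁅y⁆ {z} z∈e-x with x∈p∪q⁻ ⁅ x ⁆ ⁅ y ⁆ (p─q⊆p e ⁅ x ⁆ z∈e-x)
    ... | inj₂ z∈⁅y⁆ = z∈⁅y⁆
    ... | inj₁ z∈⁅x⁆ with refl ← x∈⁅y⁆⇒x≡y x z∈⁅x⁆ = contradiction z∈e-x (x∉p-x e x)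

    upper : ∣ e ∣ ≤ 2
    upper = ℕ.≤-trans (∣p∣≤1+∣p-x∣ e x)
      (s≤s (ℕ.≤-trans (p⊆q⇒∣p∣≤∣q∣ e-x⊆⁅y⁆) (ℕ.≤-reflexive (∣⁅x⁆∣≡1 y))))

    lower : 2 ≤ ∣ e ∣
    lower = subst (_< ∣ e ∣) (∣⁅x⁆∣≡1 x)
      (⊈⇒∣∣<∣∪∣ (λ ⁅y⁆⊆⁅x⁆ → x≢y (sym (x∈⁅y⁆⇒x≡y x (⁅y⁆⊆⁅x⁆ (x∈⁅x⁆ y))))))

  -- The two points may coincide, so singletons and pairs are treated alike in `simplicial₁`.
  ∣Y∣≤2⇒Y⊆⁅x⁆∪⁅y⁆ : {Y : Subset n} → Nonempty Y → ∣ Y ∣ ≤ 2 →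
                    ∃[ x ] ∃[ y ] (x ∈ Y × y ∈ Y × Y ⊆ ⁅ x ⁆ ∪ ⁅ y ⁆)
  ∣Y∣≤2⇒Y⊆⁅x⁆∪⁅y⁆ {Y} (x , x∈Y) ∣Y∣≤2 with nonempty? (Y - x)
  ... | no empty = x , x , x∈Y , x∈Y , Y⊆
    where
    Y⊆ : Y ⊆ ⁅ x ⁆ ∪ ⁅ x ⁆
    Y⊆ {z} z∈Y with z ≟ᶠ x
    ... | yes refl = x∈⁅x⁆∪⁅y⁆ x x
    ... | no z≢x   = contradiction (z , x∈p∧x≢y⇒x∈p-y z∈Y z≢x) empty
  ... | yes (y , y∈Y-x) = x , y , x∈Y , p─q⊆p Y ⁅ x ⁆ y∈Y-x , Y⊆
    where
    ∣Y-x-y∣≤0 : ∣ Y - x - y ∣ ≤ 0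
    ∣Y-x-y∣≤0 = ℕ.≤-pred (ℕ.≤-pred (ℕ.≤-trans (s≤s (x∈p⇒∣p-x∣<∣p∣ y∈Y-x))
      (ℕ.≤-trans (x∈p⇒∣p-x∣<∣p∣ x∈Y) ∣Y∣≤2)))

    Y⊆ : Y ⊆ ⁅ x ⁆ ∪ ⁅ y ⁆
    Y⊆ {z} z∈Y with z ≟ᶠ x | z ≟ᶠ y
    ... | yes refl | _        = x∈⁅x⁆∪⁅y⁆ x y
    ... | no _     | yes refl = y∈⁅x⁆∪⁅y⁆ x y
    ... | no z≢x   | no z≢y   = contradiction
      (ℕ.≤-trans (subst (_≤ ∣ Y - x - y ∣) (∣⁅x⁆∣≡1 z) (p⊆q⇒∣p∣≤∣q∣ (x∈p⇒⁅x⁆⊆p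
        (x∈p∧x≢y⇒x∈p-y (x∈p∧x≢y⇒x∈p-y z∈Y z≢x) z≢y)))) ∣Y-x-y∣≤0)
      λ ()

  -- Facets, deletions and simplicial faces.

  facet-above : (Γ : Complex n) {σ : Subset n} → Face Γ σ →
                ∃[ F ] (IsFacet Γ F × σ ⊆ F)
  facet-above Γ = go (⊃-wellFounded _)
    where
    go : ∀ {σ} → Acc (λ p q → q ⊂ p) σ → Face Γ σ → ∃[ F ] (IsFacet Γ F × σ ⊆ F)
    go {σ} (acc rec) σ∈Γ with anySubset? (λ τ → face? Γ τ ×-dec σ ⊂? τ)
    ... | no  ∄τ = σ , (σ∈Γ , λ τ τ∈Γ σ⊂τ → ∄τ (τ , τ∈Γ , σ⊂τ)) , ⊆-refl
    ... | yes (τ , τ∈Γ , σ⊂τ) =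
      let F , F-facet , τ⊆F = go (rec σ⊂τ) τ∈Γ
      in F , F-facet , ⊆-trans (proj₁ σ⊂τ) τ⊆F

  abdel-face⁻ : (Γ : Complex n) {R σ : Subset n} → Face (abdel R Γ) σ → Face Γ σ
  abdel-face⁻ Γ (_ , ((G∈Γ , _) , _) , σ⊆G) = closed Γ σ⊆G G∈Γ

  -- The facet `G` of `Γ` that witnesses `F` as a face survives the deletion itself, so maximality
  -- of `F` forces `F` to be `G`.
  abdel-facet⁻ : (Γ : Complex n) {R F : Subset n} →
                 IsFacet (abdel R Γ) F → IsFacet Γ F × R ⊈ F
  abdel-facet⁻ Γ ((G , (G-facet , R⊈G) , F⊆G) , F-max)
    with refl ← ⊆∧⊄⇒≡ F⊆G (F-max G (G , (G-facet , R⊈G) , ⊆-refl)) = G-facet , R⊈G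

  abdel-facet⁺ : (Γ : Complex n) {R F : Subset n} →
                 IsFacet Γ F → R ⊈ F → IsFacet (abdel R Γ) F
  abdel-facet⁺ Γ F-facet R⊈F =
    (_ , (F-facet , R⊈F) , ⊆-refl) , λ G G∈ → proj₂ F-facet G (abdel-face⁻ Γ G∈)

  deletions-face⁻ : ∀ {t j} {Γ Γ′ : Complex n} {σ} →
                    Star (Deletion t j) Γ Γ′ → Face Γ′ σ → Face Γ σ
  deletions-face⁻ ε                                   σ∈Γ  = σ∈Γ
  deletions-face⁻ {Γ = Γ} (delete _ _ _ ◅ deletions) σ∈Γ′ =
    abdel-face⁻ Γ (deletions-face⁻ deletions σ∈Γ′)

  -- A 1-clique only tests sets of at most two vertices, and the case `x = y` covers the singletons.
  simplicial₁ : (Γ : Complex n) {R : Subset n} → Face Γ R →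
    (∀ x y → Face Γ (R ∪ ⁅ x ⁆) → Face Γ (R ∪ ⁅ y ⁆) → Face Γ (⁅ x ⁆ ∪ ⁅ y ⁆)) →
    IsSimplicial 1 Γ R
  simplicial₁ Γ {R} R∈Γ edge = R∈Γ ,
    (λ x → closed Γ (q⊆p∪q R ⁅ x ⁆)) ,
    λ Y Y⊆star Y≢∅ ∣Y∣≤2 →
      let x , y , x∈Y , y∈Y , Y⊆xy = ∣Y∣≤2⇒Y⊆⁅x⁆∪⁅y⁆ Y≢∅ ∣Y∣≤2
      in closed Γ Y⊆xy (edge x y (Y⊆star x∈Y) (Y⊆star y∈Y))

  full-size⇒facet : ∀ {d} (Γ : Complex n) {F : Subset n} → DimensionAtMost d Γ →
                    Face Γ F → suc d ≤ ∣ F ∣ → IsFacet Γ F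
  full-size⇒facet Γ dim F∈Γ d<∣F∣ = F∈Γ , λ G G∈Γ F⊂G →
    ℕ.<⇒≱ (p⊂q⇒∣p∣<∣q∣ F⊂G) (ℕ.≤-trans (dim G G∈Γ) d<∣F∣)

  facet-size : ∀ {d} (Γ : Complex n) {F : Subset n} → HasDimension d Γ → Pure Γ →
               IsFacet Γ F → ∣ F ∣ ≡ suc d
  facet-size Γ {F} (dim , G , G∈Γ , ∣G∣≡) pure F-facet =
    trans (pure F G F-facet (full-size⇒facet Γ dim G∈Γ (ℕ.≤-reflexive (sym ∣G∣≡)))) ∣G∣≡

  -- Deleting by decreasing label.

  module _ (Δ : Complex n) (ℓ : Labeling Δ) where

    -- What (i) with j = d - 1 and (ii) with j = 0 have in common: all that is
    -- needed for deleting above the j-faces.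
    Linked : ℕ → Set
    Linked j = ∀ R v → ∣ R ∣ ≡ suc j → value v ∈ R →
      ∀ F G → IsFacet Δ F → IsFacet Δ G → F ≢ G → R ⊆ F → R ⊆ G →
      IsMax Δ ℓ F v → IsMax Δ ℓ G v →
      ∀ x y → x ≢ y → x ∈ (F ∪ G) - value v → y ∈ (F ∪ G) - value v →
      ∃[ H ] (IsFacet Δ H × x ∈ H × y ∈ H × H ⊆ (F ∪ G) - value v)

    LabelsBelow : ℕ → Subset n → Set
    LabelsBelow k F = ∀ w → value w ∈ F → toℕ (label Δ ℓ w) < k

    -- The invariant of the sweep. With `i = k` it determines the facets of `Γ`; with `i` one less
    -- than the upper bound it leaves open which facets with maximum label `i` have been deleted so
    -- far.
    record Between (i k : ℕ) (Γ : Complex n) : Set where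
      field
        keeps  : ∀ {F} → IsFacet Δ F → LabelsBelow i F → IsFacet Γ F
        facet⁻ : ∀ {F} → IsFacet Γ F → IsFacet Δ F
        below  : ∀ {F} → IsFacet Γ F → LabelsBelow k F

    open Between

    module _ {j : ℕ} (linked : Linked j) where

      linked⇒simplicial : ∀ {k Γ R} → Between k (suc k) Γ → (v : Vertex Δ) →
        toℕ (label Δ ℓ v) ≡ k → value v ∈ R → ∣ R ∣ ≡ suc j → Face Γ R →
        IsSimplicial 1 Γ R
      linked⇒simplicial {k} {Γ} {R} btw v ℓv≡k v∈R ∣R∣≡ R∈Γ = simplicial₁ Γ R∈Γ edge
        where
        isMax : ∀ {F} → IsFacet Γ F → R ⊆ F → IsMax Δ ℓ F v
        isMax F-facet R⊆F = R⊆F v∈R , λ w w∈F →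
          ℕ.≤-trans (ℕ.≤-pred (below btw F-facet w w∈F)) (ℕ.≤-reflexive (sym ℓv≡k))

        edge : ∀ x y → Face Γ (R ∪ ⁅ x ⁆) → Face Γ (R ∪ ⁅ y ⁆) → Face Γ (⁅ x ⁆ ∪ ⁅ y ⁆)
        edge x y Rx∈Γ Ry∈Γ
          with F , F-facet , Rx⊆F ← facet-above Γ Rx∈Γ
             | G , G-facet , Ry⊆G ← facet-above Γ Ry∈Γ = go
          where
          R⊆F : R ⊆ F
          R⊆F = ⊆-trans (p⊆p∪q ⁅ x ⁆) Rx⊆F

          R⊆G : R ⊆ G
          R⊆G = ⊆-trans (p⊆p∪q ⁅ y ⁆) Ry⊆G

          x∈F : x ∈ F
          x∈F = Rx⊆F (q⊆p∪q R ⁅ x ⁆ (x∈⁅x⁆ x))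

          y∈G : y ∈ G
          y∈G = Ry⊆G (q⊆p∪q R ⁅ y ⁆ (x∈⁅x⁆ y))

          within : ∀ {H} → IsFacet Γ H → x ∈ H → y ∈ H → Face Γ (⁅ x ⁆ ∪ ⁅ y ⁆)
          within H-facet x∈H y∈H = closed Γ (⁅x⁆∪⁅y⁆⊆p x∈H y∈H) (proj₁ H-facet)

          -- Labels in `F ∪ G` are at most `k`, and only `v` has label `k`. Hence `keeps` applies to
          -- `H`: no deletion so far has touched it.
          labels<k : ∀ {H} → H ⊆ (F ∪ G) - value v → LabelsBelow k H
          labels<k H⊆ w w∈H = ℕ.≤∧≢⇒< ℓw≤k λ ℓw≡k →
            x∉p-x (F ∪ G) (value v) (subst (_∈ _)
              (cong value (Bijection.injective (proj₂ ℓ)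
                (toℕ-injective (trans ℓw≡k (sym ℓv≡k)))))
              (H⊆ w∈H))
            where
            ℓw≤k : toℕ (label Δ ℓ w) ≤ k
            ℓw≤k = ℕ.≤-pred ([ below btw F-facet w , below btw G-facet w ]′
              (x∈p∪q⁻ F G (p─q⊆p (F ∪ G) ⁅ value v ⁆ (H⊆ w∈H))))

          go : Face Γ (⁅ x ⁆ ∪ ⁅ y ⁆)
          -- `linked` is used only for distinct facets and distinct vertices other than `v`. In the
          -- other cases `F` or `G` alone contains both vertices, since `v` lies in both facets.
          go with F ≟ˢ G
          ... | yes refl = within F-facet x∈F y∈G
          ... | no F≢G with x ≟ᶠ y | x ≟ᶠ value v | y ≟ᶠ value v
          ... | yes refl | _ | _        = within F-facet x∈F x∈F
          ... | no _ | yes refl | _     = within G-facet (R⊆G v∈R) y∈G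
          ... | no _ | no _ | yes refl  = within F-facet x∈F (R⊆F v∈R)
          ... | no x≢y | no x≢v | no y≢v =
            let H , H-facet , x∈H , y∈H , H⊆ =
                  linked R v ∣R∣≡ v∈R F G (facet⁻ btw F-facet) (facet⁻ btw G-facet)
                    F≢G R⊆F R⊆G (isMax F-facet R⊆F) (isMax G-facet R⊆G) x y x≢y
                    (x∈p∧x≢y⇒x∈p-y (x∈p∪q⁺ (inj₁ x∈F)) x≢v)
                    (x∈p∧x≢y⇒x∈p-y (x∈p∪q⁺ {p = F} (inj₂ y∈G)) y≢v)
            in within (keeps btw H-facet (labels<k H⊆)) x∈H y∈H

      -- Running through a list of all candidates R, whether or not they are
      -- still faces, makes the process terminate without a measure.
      delete-above-all : ∀ {k Γ} (v : Vertex Δ) → toℕ (label Δ ℓ v) ≡ k →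
        Between k (suc k) Γ → (Rs : List (Subset n)) →
        ∃[ Γ′ ] (Star (Deletion 1 j) Γ Γ′ × Between k (suc k) Γ′ ×
          All (λ R → value v ∈ R → ∣ R ∣ ≡ suc j → ¬ Face Γ′ R) Rs)
      delete-above-all v ℓv≡k btw [] = _ , ε , btw , []
      delete-above-all {k} {Γ} v ℓv≡k btw (R ∷ Rs)
        with value v ∈? R ×-dec ∣ R ∣ ℕ.≟ suc j ×-dec face? Γ R
      ... | no ¬R =
        let Γ′ , dels , btw′ , gone = delete-above-all v ℓv≡k btw Rs
        in Γ′ , dels , btw′ ,
           -- Deletions create no faces, so a set that is not a face now never becomes one.
           (λ v∈R ∣R∣≡ R∈Γ′ → ¬R (v∈R , ∣R∣≡ , deletions-face⁻ dels R∈Γ′)) ∷ gone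
      ... | yes (v∈R , ∣R∣≡ , R∈Γ) =
        let Γ′ , dels , btw′ , gone = delete-above-all v ℓv≡k btw-R Rs
        in Γ′ ,
           delete R ∣R∣≡ (linked⇒simplicial btw v ℓv≡k v∈R ∣R∣≡ R∈Γ) ◅ dels ,
           btw′ ,
           (λ _ _ R∈Γ′ → R∉abdel (deletions-face⁻ dels R∈Γ′)) ∷ gone
        where
        R∉abdel : ¬ Face (abdel R Γ) R
        R∉abdel (_ , (_ , R⊈G) , R⊆G) = R⊈G R⊆G

        btw-R : Between k (suc k) (abdel R Γ)
        -- A facet with all labels below `k` misses `v`, so it cannot contain `R`.
        btw-R .keeps F-facet F<k = abdel-facet⁺ Γ (keeps btw F-facet F<k)
          (λ R⊆F → ℕ.<-irrefl ℓv≡k (F<k v (R⊆F v∈R)))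
        btw-R .facet⁻ = facet⁻ btw ∘ proj₁ ∘ abdel-facet⁻ Γ
        btw-R .below  = below btw ∘ proj₁ ∘ abdel-facet⁻ Γ

      module _ (large : ∀ {F} → IsFacet Δ F → suc j ≤ ∣ F ∣) where

        -- By `large`, a remaining facet through `v` would contain a set of `j + 1` vertices through
        -- `v`, and none of these is a face any more.
        settled : ∀ {k Γ} (v : Vertex Δ) → toℕ (label Δ ℓ v) ≡ k → Between k (suc k) Γ →
          All (λ R → value v ∈ R → ∣ R ∣ ≡ suc j → ¬ Face Γ R) (allSubsets n) →
          Between k k Γ
        settled {k} {Γ} v ℓv≡k btw gone = record
          { keeps = keeps btw ; facet⁻ = facet⁻ btw ; below = below-k }
          where
          v∉facet : ∀ {F} → IsFacet Γ F → ¬ (value v ∈ F)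
          v∉facet {F} F-facet v∈F =
            let R , v⊆R , R⊆F , ∣R∣≡ = ⊆-intermediate (x∈p⇒⁅x⁆⊆p v∈F)
                  (ℕ.≤-trans (ℕ.≤-reflexive (∣⁅x⁆∣≡1 (value v))) (s≤s z≤n))
                  (large (facet⁻ btw F-facet))
            in All.lookup gone (∈-allSubsets R) (v⊆R (x∈⁅x⁆ (value v))) ∣R∣≡
                 (closed Γ R⊆F (proj₁ F-facet))

          below-k : ∀ {F} → IsFacet Γ F → LabelsBelow k F
          below-k {F} F-facet w w∈F =
            ℕ.≤∧≢⇒< (ℕ.≤-pred (below btw F-facet w w∈F)) λ ℓw≡k →
              v∉facet F-facet (subst (_∈ F)
                (cong value (Bijection.injective (proj₂ ℓ)
                  (toℕ-injective (trans ℓw≡k (sym ℓv≡k))))) w∈F)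

        sweep : ∀ k {Γ} → k ≤ proj₁ ℓ → Between k k Γ →
                ∃[ Γ′ ] (Star (Deletion 1 j) Γ Γ′ × Between 0 0 Γ′)
        sweep zero    _   btw = _ , ε , btw
        sweep (suc k) {Γ} k<m btw =
          let v , ℓv≡ = Bijection.strictlySurjective (proj₂ ℓ) (fromℕ< k<m)
              ℓv≡k = trans (cong toℕ ℓv≡) (toℕ-fromℕ< k<m)
              Γ′ , dels , btw′ , gone = delete-above-all v ℓv≡k btw⁻ (allSubsets n)
              Γ″ , dels′ , btw″ = sweep k (ℕ.<⇒≤ k<m) (settled v ℓv≡k btw′ gone)
          in Γ″ , dels ◅◅ dels′ , btw″
          where
          -- Only the lower bound is relaxed: facets with maximum label `k` now become open to
          -- deletion.
          btw⁻ : Between k (suc k) Γ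
          btw⁻ .keeps F-facet F<k = keeps btw F-facet (λ w w∈F → ℕ.m<n⇒m<1+n (F<k w w∈F))
          btw⁻ .facet⁻ = facet⁻ btw
          btw⁻ .below  = below btw

        linked⇒reducible : ReducibleBy 1 j Δ
        linked⇒reducible =
          let Γ , dels , btw = sweep (proj₁ ℓ) ℕ.≤-refl start
          in Γ , dels , dim btw
          where
          start : Between (proj₁ ℓ) (proj₁ ℓ) Δ
          start .keeps F-facet _ = F-facet
          start .facet⁻ F-facet  = F-facet
          start .below _ w _     = toℕ<n (label Δ ℓ w)

          -- No label is below 0, so every facet that remains is empty.
          dim : ∀ {Γ} → Between 0 0 Γ → DimensionAtMost j Γ
          dim {Γ} btw σ σ∈Γ with F , F-facet , σ⊆F ← facet-above Γ σ∈Γ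
            with nonempty? F
          ... | yes (x , x∈F) = contradiction
            (below btw F-facet
              (x , [ closed Δ (x∈p⇒⁅x⁆⊆p x∈F) (proj₁ (facet⁻ btw F-facet)) ]) x∈F)
            λ ()
          ... | no F-empty with refl ← Empty-unique F-empty =
            ℕ.≤-trans (p⊆q⇒∣p∣≤∣q∣ σ⊆F) (ℕ.≤-trans (ℕ.≤-reflexive (∣⊥∣≡0 n)) z≤n)

-- The two implications.

veryWeaklyChordal⇒weaklyRidgeChordal : ∀ n d (Δ : Complex n) → 1 ≤ d →
  HasDimension d Δ → Pure Δ → VeryWeaklyChordal Δ → WeaklyRidgeChordal d Δ
veryWeaklyChordal⇒weaklyRidgeChordal n (suc d) Δ _ hasDim@(dim , _) pure (ℓ , vwc) =
  hasDim , ℕ.≤-refl , linked⇒reducible Δ ℓ linked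
    (λ F-facet → ℕ.≤-trans (ℕ.n≤1+n _) (ℕ.≤-reflexive (sym (size F-facet))))
  where
  size : ∀ {F} → IsFacet Δ F → ∣ F ∣ ≡ suc (suc d)
  size = facet-size Δ hasDim pure

  -- Distinct facets sharing a ridge are adjacent, and the single face `(F ∪ G) - v` then serves all
  -- pairs `x`, `y` at once.
  linked : Linked Δ ℓ d
  linked R v ∣R∣≡ v∈R F G F-facet G-facet F≢G R⊆F R⊆G F-max G-max x y _ x∈ y∈ =
    H , full-size⇒facet Δ dim H∈Δ ∣H∣≥ , x∈ , y∈ , ⊆-refl
    where
    H = (F ∪ G) - value v

    F⊈G : F ⊈ G
    F⊈G F⊆G = F≢G (⊆∧∣∣≥⇒≡ F⊆G (ℕ.≤-reflexive (pure G F G-facet F-facet)))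

    G⊈F : G ⊈ F
    G⊈F G⊆F = F≢G (sym (⊆∧∣∣≥⇒≡ G⊆F (ℕ.≤-reflexive (pure F G F-facet G-facet))))

    adjacent : Adjacent F G
    adjacent = pure F G F-facet G-facet ,
      ℕ.≤-antisym (⊈⇒∣∩∣<∣∣ F⊈G)
        (ℕ.≤-trans (ℕ.≤-reflexive (trans (size F-facet) (cong suc (sym ∣R∣≡))))
          (s≤s (p⊆q⇒∣p∣≤∣q∣ (λ z∈R → x∈p∩q⁺ (R⊆F z∈R , R⊆G z∈R)))))

    H∈Δ : Face Δ H
    H∈Δ = vwc F G v F-facet G-facet F≢G adjacent F-max G-max

    -- `F ∪ G` is strictly larger than `F`, so without one vertex it is still at least as large as
    -- `F`; this makes `H` a facet.
    ∣H∣≥ : suc (suc d) ≤ ∣ H ∣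
    ∣H∣≥ = ℕ.≤-trans (ℕ.≤-reflexive (sym (size F-facet)))
      (ℕ.≤-pred (ℕ.≤-trans (⊈⇒∣∣<∣∪∣ G⊈F) (∣p∣≤1+∣p-x∣ (F ∪ G) (value v))))

-- The face that mid-chordality provides for the pair `x`, `y` has the size of `F`, hence is a facet
-- by dimension.
midChordal⇒weaklyVertexChordal : ∀ n d (Δ : Complex n) → 1 ≤ d →
  HasDimension d Δ → Pure Δ → MidChordal Δ → WeaklyVertexChordal d Δ
midChordal⇒weaklyVertexChordal n d Δ 1≤d hasDim@(dim , _) pure (ℓ , mid) =
  hasDim , 1≤d , linked⇒reducible Δ ℓ linked
    (λ F-facet → ℕ.≤-trans (s≤s z≤n) (ℕ.≤-reflexive (sym (size F-facet))))
  where
  size : ∀ {F} → IsFacet Δ F → ∣ F ∣ ≡ suc d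
  size = facet-size Δ hasDim pure

  linked : Linked Δ ℓ 0
  linked _ v _ _ F G F-facet G-facet F≢G _ _ F-max G-max x y x≢y x∈ y∈ =
    let _ , H , H∈Δ , ∣H∣≡∣F∣ , e⊆H , H⊆ =
          mid F G v F-facet G-facet F≢G (pure F G F-facet G-facet) F-max G-max
            (⁅ x ⁆ ∪ ⁅ y ⁆) (∣⁅x⁆∪⁅y⁆∣≡2 x≢y) (⁅x⁆∪⁅y⁆⊆p x∈ y∈)
    in H ,
       full-size⇒facet Δ dim H∈Δ (ℕ.≤-reflexive (sym (trans ∣H∣≡∣F∣ (size F-facet)))) ,
       e⊆H (x∈⁅x⁆∪⁅y⁆ x y) , e⊆H (y∈⁅x⁆∪⁅y⁆ x y) , H⊆

-- Complexes given by a list of facets of equal size.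

module _ {n : ℕ} where

  generatedBy : List (Subset n) → Complex n
  generatedBy L .Face σ  = Any (σ ⊆_) L
  generatedBy L .face? σ = Any.any? (σ ⊆?_) L
  generatedBy L .closed {σ} {τ} σ⊆τ = Any.map {P = τ ⊆_} {Q = σ ⊆_} (λ τ⊆F {x} → ⊆-trans σ⊆τ τ⊆F)

  Uniform : ℕ → List (Subset n) → Set
  Uniform d = All (λ F → ∣ F ∣ ≡ suc d)

  generated-facet⁻ : ∀ {L F} → IsFacet (generatedBy L) F → F List.∈ L
  generated-facet⁻ {L} {F} (F∈ , F-max) with G , G∈L , F⊆G ← List.find F∈
    with refl ← ⊆∧⊄⇒≡ F⊆G (F-max G (List.lose G∈L ⊆-refl)) = G∈L

  generated-dimension : ∀ {d L} → Uniform d L → DimensionAtMost d (generatedBy L)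
  generated-dimension uniform F F∈ with G , G∈L , F⊆G ← List.find F∈ =
    ℕ.≤-trans (p⊆q⇒∣p∣≤∣q∣ F⊆G) (ℕ.≤-reflexive (All.lookup uniform G∈L))

  generated-facet⁺ : ∀ {d L F} → Uniform d L → F List.∈ L → IsFacet (generatedBy L) F
  generated-facet⁺ {L = L} uniform F∈L =
    full-size⇒facet (generatedBy L) (generated-dimension uniform)
      (List.lose F∈L ⊆-refl) (ℕ.≤-reflexive (sym (All.lookup uniform F∈L)))

  generated-pure : ∀ {d L} → Uniform d L → Pure (generatedBy L)
  generated-pure uniform F G F-facet G-facet =
    trans (All.lookup uniform (generated-facet⁻ F-facet))
          (sym (All.lookup uniform (generated-facet⁻ G-facet)))

  generated-hasDimension : ∀ {d F L} → Uniform d (F ∷ L) → HasDimension d (generatedBy (F ∷ L))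
  generated-hasDimension {F = F} uniform@(∣F∣≡ ∷ _) =
    generated-dimension uniform , F , here ⊆-refl , ∣F∣≡

  infix 4 _≋_
  -- `abdel` and `generatedBy` describe their faces by different types, so complexes are compared by
  -- logical equivalence of their face predicates.
  record _≋_ (Γ Γ′ : Complex n) : Set where
    field
      to   : ∀ {σ} → Face Γ σ → Face Γ′ σ
      from : ∀ {σ} → Face Γ′ σ → Face Γ σ

  open _≋_

  ≋-refl : ∀ {Γ} → Γ ≋ Γ
  ≋-refl = record { to = id ; from = id }

  ≋-sym : ∀ {Γ Γ′} → Γ ≋ Γ′ → Γ′ ≋ Γ
  ≋-sym Γ≋Γ′ = record { to = from Γ≋Γ′ ; from = to Γ≋Γ′ }

  facet-resp : ∀ {Γ Γ′ F} → Γ ≋ Γ′ → IsFacet Γ F → IsFacet Γ′ F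
  facet-resp Γ≋Γ′ (F∈Γ , F-max) = to Γ≋Γ′ F∈Γ , λ G G∈Γ′ → F-max G (from Γ≋Γ′ G∈Γ′)

  simplicial-resp : ∀ {t Γ Γ′ F} → Γ ≋ Γ′ → IsSimplicial t Γ F → IsSimplicial t Γ′ F
  simplicial-resp Γ≋Γ′ (F∈Γ , vertices , faces) =
    to Γ≋Γ′ F∈Γ ,
    (λ x → to Γ≋Γ′ ∘ vertices x ∘ from Γ≋Γ′) ,
    λ Y Y⊆star Y≢∅ ∣Y∣≤ → to Γ≋Γ′ (faces Y (from Γ≋Γ′ ∘ Y⊆star) Y≢∅ ∣Y∣≤)

  infixl 6 _without_
  _without_ : List (Subset n) → Subset n → List (Subset n)
  L without R = filter (λ F → ¬? (R ⊆? F)) L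

  -- Generators of equal size are exactly the facets, so deleting above `R` amounts to filtering the
  -- list.
  abdel-generated : ∀ {d L Γ} R → Uniform d L → Γ ≋ generatedBy L →
                    abdel R Γ ≋ generatedBy (L without R)
  abdel-generated {L = L} {Γ} R uniform Γ≋L = record { to = to′ ; from = from′ }
    where
    R⊈? : ∀ F → Dec (R ⊈ F)
    R⊈? F = ¬? (R ⊆? F)

    to′ : ∀ {σ} → Face (abdel R Γ) σ → Face (generatedBy (L without R)) σ
    to′ (G , (G-facet , R⊈G) , σ⊆G) = List.lose
      (∈-filter⁺ R⊈? (generated-facet⁻ (facet-resp Γ≋L G-facet)) R⊈G) σ⊆G

    from′ : ∀ {σ} → Face (generatedBy (L without R)) σ → Face (abdel R Γ) σ
    from′ σ∈ with G , G∈ , σ⊆G ← List.find σ∈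
      with G∈L , R⊈G ← ∈-filter⁻ R⊈? {xs = L} G∈ =
      G , (facet-resp (≋-sym Γ≋L) (generated-facet⁺ uniform G∈L) , R⊈G) , σ⊆G

  -- Deciding simpliciality and checking reductions.

  MissingFace : ℕ → Complex n → (F Y : Subset n) → Set
  MissingFace t Γ F Y =
    ∣ Y ∣ ≤ suc t × Nonempty Y × ¬ Face Γ Y × Lift (λ x → InStar Γ F ⁅ x ⁆) Y

  missingFace? : ∀ t Γ F Y → Dec (MissingFace t Γ F Y)
  missingFace? t Γ F Y = ∣ Y ∣ ℕ.≤? suc t ×-dec nonempty? Y ×-dec ¬? (face? Γ Y) ×-dec
    Lift? (λ x → face? Γ (F ∪ ⁅ x ⁆)) Y

  -- Points of the star are vertices by closure, so a face can fail to be simplicial only through a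
  -- missing face, and a finite search finds one if it exists.
  isSimplicial? : ∀ t (Γ : Complex n) F → Dec (IsSimplicial t Γ F)
  isSimplicial? t Γ F =
    face? Γ F ×-dec map′ clique noMissing (¬? (anySubset? (missingFace? t Γ F)))
    where
    clique : ¬ (∃[ Y ] MissingFace t Γ F Y) → IsClique t Γ (λ x → InStar Γ F ⁅ x ⁆)
    clique ∄Y = (λ x → closed Γ (q⊆p∪q F ⁅ x ⁆)) ,
      λ Y Y⊆star Y≢∅ ∣Y∣≤ → decidable-stable (face? Γ Y)
        λ Y∉Γ → ∄Y (Y , ∣Y∣≤ , Y≢∅ , Y∉Γ , Y⊆star)

    noMissing : IsClique t Γ (λ x → InStar Γ F ⁅ x ⁆) → ¬ (∃[ Y ] MissingFace t Γ F Y)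
    noMissing (_ , faces) (Y , ∣Y∣≤ , Y≢∅ , Y∉Γ , Y⊆star) = Y∉Γ (faces Y Y⊆star Y≢∅ ∣Y∣≤)

  -- A certificate for `ReducibleBy` that evaluation can check: `Rs` lists the faces to delete, in
  -- order, and each intermediate complex is represented by its generators.
  Reduces : (t j : ℕ) (L Rs : List (Subset n)) → Set
  Reduces t j L []       = All (λ F → ∣ F ∣ ≤ suc j) L
  Reduces t j L (R ∷ Rs) =
    (∣ R ∣ ≡ suc j × IsSimplicial t (generatedBy L) R) × Reduces t j (L without R) Rs

  reduces? : ∀ t j L Rs → Dec (Reduces t j L Rs)
  reduces? t j L []       = All.all? (λ F → ∣ F ∣ ℕ.≤? suc j) L
  reduces? t j L (R ∷ Rs) =
    (∣ R ∣ ℕ.≟ suc j ×-dec isSimplicial? t (generatedBy L) R) ×-dec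
    reduces? t j (L without R) Rs

  reduces⇒reducible : ∀ {t j d L Γ} → Uniform d L → Γ ≋ generatedBy L →
                      ∀ Rs → Reduces t j L Rs → ReducibleBy t j Γ
  reduces⇒reducible {Γ = Γ} _ Γ≋L [] small = Γ , ε , dim
    where
    dim : DimensionAtMost _ Γ
    dim σ σ∈Γ with F , F∈L , σ⊆F ← List.find (to Γ≋L σ∈Γ) =
      ℕ.≤-trans (p⊆q⇒∣p∣≤∣q∣ σ⊆F) (All.lookup small F∈L)
  reduces⇒reducible uniform Γ≋L (R ∷ Rs) ((∣R∣≡ , R-simplicial) , reduces) =
    let Γ′ , deletions , dim =
          reduces⇒reducible (All.filter⁺ (λ F → ¬? (R ⊆? F)) uniform)
            (abdel-generated R uniform Γ≋L) Rs reduces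
    in Γ′ , delete R ∣R∣≡ (simplicial-resp (≋-sym Γ≋L) R-simplicial) ◅ deletions , dim

  NoSimplicialFace : (t j : ℕ) → Complex n → Set
  NoSimplicialFace t j Γ = ¬ (∃[ R ] (∣ R ∣ ≡ suc j × IsSimplicial t Γ R))

  noSimplicialFace? : ∀ t j Γ → Dec (NoSimplicialFace t j Γ)
  noSimplicialFace? t j Γ =
    ¬? (anySubset? λ R → ∣ R ∣ ℕ.≟ suc j ×-dec isSimplicial? t Γ R)

  noSimplicialFace⇒¬reducible : ∀ {t j d} {Γ : Complex n} → j < d → HasDimension d Γ →
                                NoSimplicialFace t j Γ → ¬ ReducibleBy t j Γ
  -- The empty sequence of deletions leaves a face of dimension `d`, which exceeds `j`.
  noSimplicialFace⇒¬reducible j<d (_ , F , F∈Γ , ∣F∣≡) _ (_ , ε , dim) =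
    ℕ.<⇒≱ j<d (ℕ.≤-pred (ℕ.≤-trans (ℕ.≤-reflexive (sym ∣F∣≡)) (dim F F∈Γ)))
  noSimplicialFace⇒¬reducible _ _ none (_ , delete R ∣R∣≡ R-simplicial ◅ _ , _) =
    none (R , ∣R∣≡ , R-simplicial)

  -- Refuting and verifying chordality conditions.

  top-vertex : (Γ : Complex n) (ℓ : Labeling Γ) → Vertex Γ →
               ∃[ v ] (∀ w → label Γ ℓ w Fin.≤ label Γ ℓ v)
  top-vertex Γ (zero  , b) w₀ with () ← Bijection.to b w₀
  top-vertex Γ (suc m , b) _ =
    let v , ℓv≡ = Bijection.strictlySurjective b (fromℕ m)
    in v , λ w → subst (Bijection.to b w Fin.≤_) (sym ℓv≡) (≤fromℕ _)

  -- A pair of adjacent facets that violates both chordality conditions for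
  -- every labeling in which v comes last.
  ObstructedAt : List (Subset n) → Fin n → Set
  ObstructedAt L v = Any (λ F → Any (λ G →
    (v ∈ F × v ∈ G) × F ≢ G × Adjacent F G ×
    2 ≤ ∣ F ∣ × ∣ (F ∪ G) - v ∣ ≡ ∣ F ∣ × ¬ Face (generatedBy L) ((F ∪ G) - v)) L) L

  obstructedAt? : ∀ L v → Dec (ObstructedAt L v)
  obstructedAt? L v = Any.any? (λ F → Any.any? (λ G →
    (v ∈? F ×-dec v ∈? G) ×-dec ¬? (F ≟ˢ G) ×-dec
    (∣ F ∣ ℕ.≟ ∣ G ∣ ×-dec suc ∣ F ∩ G ∣ ℕ.≟ ∣ F ∣) ×-dec
    2 ℕ.≤? ∣ F ∣ ×-dec ∣ (F ∪ G) - v ∣ ℕ.≟ ∣ F ∣ ×-dec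
    ¬? (face? (generatedBy L) ((F ∪ G) - v))) L) L

  module _ {d : ℕ} {L : List (Subset n)} (uniform : Uniform d L)
           (obstructed : ∀ v → ObstructedAt L v) (w₀ : Vertex (generatedBy L)) where

    obstructed⇒¬veryWeaklyChordal : ¬ VeryWeaklyChordal (generatedBy L)
    obstructed⇒¬veryWeaklyChordal (ℓ , vwc)
      with v , top ← top-vertex (generatedBy L) ℓ w₀
      with F , F∈L , obstructedF ← List.find (obstructed (value v))
      with G , G∈L , (v∈F , v∈G) , F≢G , adjacent , _ , _ , F∪G-v∉ ← List.find obstructedF =
      F∪G-v∉ (vwc F G v (generated-facet⁺ uniform F∈L) (generated-facet⁺ uniform G∈L)
        F≢G adjacent (v∈F , λ w _ → top w) (v∈G , λ w _ → top w))

    -- Any pair `e` inside `(F ∪ G) - v` yields a face `H` in that set. Both have the size of `F`,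
    -- so they coincide, although `(F ∪ G) - v` is not a face.
    obstructed⇒¬midChordal : ¬ MidChordal (generatedBy L)
    obstructed⇒¬midChordal (ℓ , mid)
      with v , top ← top-vertex (generatedBy L) ℓ w₀
      with F , F∈L , obstructedF ← List.find (obstructed (value v))
      with G , G∈L , (v∈F , v∈G) , F≢G , (∣F∣≡∣G∣ , _) , 2≤∣F∣ , ∣F∪G-v∣≡∣F∣ , F∪G-v∉
        ← List.find obstructedF
      with e , _ , e⊆ , ∣e∣≡2 ← ⊆-intermediate (⊥⊆ {p = (F ∪ G) - value v})
        (ℕ.≤-trans (ℕ.≤-reflexive (∣⊥∣≡0 n)) z≤n)
        (ℕ.≤-trans 2≤∣F∣ (ℕ.≤-reflexive (sym ∣F∪G-v∣≡∣F∣)))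
      with _ , H , H∈ , ∣H∣≡∣F∣ , _ , H⊆ ←
        mid F G v (generated-facet⁺ uniform F∈L) (generated-facet⁺ uniform G∈L)
          F≢G ∣F∣≡∣G∣ (v∈F , λ w _ → top w) (v∈G , λ w _ → top w) e ∣e∣≡2 e⊆ =
      F∪G-v∉ (subst (Face (generatedBy L))
        (⊆∧∣∣≥⇒≡ H⊆ (ℕ.≤-reflexive (trans ∣F∪G-v∣≡∣F∣ (sym ∣H∣≡∣F∣)))) H∈)

  identityLabeling : (Γ : Complex n) → (∀ x → IsVertex Γ x) → Labeling Γ
  identityLabeling Γ vertex = n , mk⤖ (value-injective , λ x → (x , [ vertex x ]) , cong value)

  -- Mid-chordality for `identityLabeling`, with the quantifier over `e` as a negated existential so
  -- that `anySubset?` can search for a counterexample.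
  MidLinked : List (Subset n) → Set
  MidLinked L = All (λ F → All (λ G → ∀ v →
    (v ∈ F × v ∈ G) × F ≢ G ×
    (∀ w → w ∈ F → w Fin.≤ v) × (∀ w → w ∈ G → w Fin.≤ v) →
    ¬ (∃[ e ] ((∣ e ∣ ≡ 2 × e ⊆ (F ∪ G) - v) ×
      ¬ Any (λ H → e ⊆ H × H ⊆ (F ∪ G) - v) L))) L) L

  midLinked? : ∀ L → Dec (MidLinked L)
  midLinked? L = All.all? (λ F → All.all? (λ G → all? λ v →
    ((v ∈? F ×-dec v ∈? G) ×-dec ¬? (F ≟ˢ G) ×-dec
     all? (λ w → w ∈? F →-dec w ≤ᶠ? v) ×-dec all? (λ w → w ∈? G →-dec w ≤ᶠ? v)) →-dec
    ¬? (anySubset? λ e → (∣ e ∣ ℕ.≟ 2 ×-dec e ⊆? (F ∪ G) - v) ×-dec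
      ¬? (Any.any? (λ H → e ⊆? H ×-dec H ⊆? (F ∪ G) - v) L))) L) L

  midLinked⇒midChordal : ∀ {d L} → Uniform d L → (∀ x → IsVertex (generatedBy L) x) →
                         MidLinked L → MidChordal (generatedBy L)
  midLinked⇒midChordal {L = L} uniform vertex linked .proj₁ =
    identityLabeling (generatedBy L) vertex
  midLinked⇒midChordal {L = L} uniform vertex linked .proj₂
    F G v F-facet G-facet F≢G ∣F∣≡∣G∣ (v∈F , F≤v) (v∈G , G≤v) e ∣e∣≡2 e⊆
    with H , H∈L , e⊆H , H⊆ ← List.find (decidable-stable
      (Any.any? (λ H → e ⊆? H ×-dec H ⊆? (F ∪ G) - value v) L)
      λ ∄H → All.lookup (All.lookup linked (generated-facet⁻ F-facet))
        (generated-facet⁻ G-facet) (value v)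
        ((v∈F , v∈G) , F≢G , (λ w → F≤v (w , [ vertex w ])) , (λ w → G≤v (w , [ vertex w ])))
        (e , (∣e∣≡2 , (λ {x} → e⊆ {x})) , ∄H)) =
    List.lose H∈L e⊆H , H , List.lose H∈L ⊆-refl ,
    trans (All.lookup uniform H∈L) (sym (All.lookup uniform (generated-facet⁻ F-facet))) ,
    e⊆H , H⊆

-- The two examples.

triangle : ∀ {n} → Fin n → Fin n → Fin n → Subset n
triangle x y z = ⁅ x ⁆ ∪ (⁅ y ⁆ ∪ ⁅ z ⁆)

-- The 5-vertex Möbius strip, with triangles `i`, `i + 1`, `i + 2` modulo 5. The triangles on
-- `v - 2`, `v - 1`, `v` and on `v - 1`, `v`, `v + 1` obstruct at `v`.
mobius : List (Subset 5)
mobius = triangle 0F 1F 2F ∷ triangle 1F 2F 3F ∷ triangle 2F 3F 4F ∷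
         triangle 3F 4F 0F ∷ triangle 4F 0F 1F ∷ []

mobius-uniform : Uniform 2 mobius
mobius-uniform = from-yes (All.all? (λ F → ∣ F ∣ ℕ.≟ 3) mobius)

mobius-obstructed : ∀ v → ObstructedAt mobius v
mobius-obstructed = from-yes (all? (obstructedAt? mobius))

-- The boundary edges `i`, `i + 2`: each lies in exactly one triangle, so its star is a single
-- simplex.
mobius-ridges : List (Subset 5)
mobius-ridges = ⁅ 0F ⁆ ∪ ⁅ 2F ⁆ ∷ ⁅ 1F ⁆ ∪ ⁅ 3F ⁆ ∷ ⁅ 2F ⁆ ∪ ⁅ 4F ⁆ ∷
                ⁅ 3F ⁆ ∪ ⁅ 0F ⁆ ∷ ⁅ 4F ⁆ ∪ ⁅ 1F ⁆ ∷ []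

mobius-ridgeChordal : RidgeChordal 2 (generatedBy mobius)
mobius-ridgeChordal = generated-hasDimension mobius-uniform , ℕ.≤-refl ,
  reduces⇒reducible mobius-uniform ≋-refl mobius-ridges
    (from-yes (reduces? 2 1 mobius mobius-ridges))

mobius-weaklyRidgeChordal : WeaklyRidgeChordal 2 (generatedBy mobius)
mobius-weaklyRidgeChordal = generated-hasDimension mobius-uniform , ℕ.≤-refl ,
  reduces⇒reducible mobius-uniform ≋-refl mobius-ridges
    (from-yes (reduces? 1 1 mobius mobius-ridges))

-- All ten pairs are edges of the strip, so 0 is 1-simplicial. Then only 123 and 234 remain, and
-- each further vertex lies in one triangle when its turn comes.
mobius-vertices : List (Subset 5)
mobius-vertices = ⁅ 0F ⁆ ∷ ⁅ 1F ⁆ ∷ ⁅ 2F ⁆ ∷ []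

mobius-weaklyVertexChordal : WeaklyVertexChordal 2 (generatedBy mobius)
mobius-weaklyVertexChordal = generated-hasDimension mobius-uniform , s≤s z≤n ,
  reduces⇒reducible mobius-uniform ≋-refl mobius-vertices
    (from-yes (reduces? 1 0 mobius mobius-vertices))

mobius-vertex : Vertex (generatedBy mobius)
mobius-vertex = 0F , [ from-yes (face? (generatedBy mobius) ⁅ 0F ⁆) ]

mobius-¬midChordal : ¬ MidChordal (generatedBy mobius)
mobius-¬midChordal =
  obstructed⇒¬midChordal mobius-uniform mobius-obstructed mobius-vertex

mobius-¬veryWeaklyChordal : ¬ VeryWeaklyChordal (generatedBy mobius)
mobius-¬veryWeaklyChordal =
  obstructed⇒¬veryWeaklyChordal mobius-uniform mobius-obstructed mobius-vertex

-- The boundary of the tetrahedron 0123, coned twice over 4-cycles through its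
-- vertices: 4 is joined to 0-1-2-3 and 5 to 0-2-1-3.  Every edge of the
-- tetrahedron lies in one of the cycles, which keeps it from being simplicial.
doubleCone : List (Subset 6)
doubleCone =
  triangle 0F 1F 2F ∷ triangle 1F 2F 3F ∷ triangle 2F 3F 0F ∷ triangle 3F 0F 1F ∷
  triangle 0F 1F 4F ∷ triangle 1F 2F 4F ∷ triangle 2F 3F 4F ∷ triangle 3F 0F 4F ∷
  triangle 0F 2F 5F ∷ triangle 2F 1F 5F ∷ triangle 1F 3F 5F ∷ triangle 3F 0F 5F ∷ []

doubleCone-uniform : Uniform 2 doubleCone
doubleCone-uniform = from-yes (All.all? (λ F → ∣ F ∣ ℕ.≟ 3) doubleCone)

doubleCone-vertex : ∀ x → IsVertex (generatedBy doubleCone) x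
doubleCone-vertex = from-yes (all? λ x → face? (generatedBy doubleCone) ⁅ x ⁆)

-- Two facets with maximum 4 or 5 leave three or all four vertices of the tetrahedron, whose
-- triangles are all present; two facets with maximum 3 leave the triangle 012.
doubleCone-midChordal : MidChordal (generatedBy doubleCone)
doubleCone-midChordal = midLinked⇒midChordal doubleCone-uniform doubleCone-vertex
  (from-yes (midLinked? doubleCone))

doubleCone-¬ridgeChordal : ¬ RidgeChordal 2 (generatedBy doubleCone)
doubleCone-¬ridgeChordal (hasDim , 1<2 , reducible) =
  noSimplicialFace⇒¬reducible 1<2 hasDim
    (from-yes (noSimplicialFace? 2 1 (generatedBy doubleCone))) reducible

-- The star of every vertex contains a cone point together with two opposite vertices of its
-- 4-cycle, and these three span no face.
doubleCone-¬vertexChordal : ¬ VertexChordal 2 (generatedBy doubleCone)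
doubleCone-¬vertexChordal (hasDim , 0<2 , reducible) =
  noSimplicialFace⇒¬reducible 0<2 hasDim
    (from-yes (noSimplicialFace? 2 0 (generatedBy doubleCone))) reducible

theorem91 : (∀ n d (Δ : Complex n) → 1 ≤ d → HasDimension d Δ →
    Pure Δ → VeryWeaklyChordal Δ → WeaklyRidgeChordal d Δ)
    ×
    (∀ n d (Δ : Complex n) → 1 ≤ d → HasDimension d Δ →
    Pure Δ → MidChordal Δ → WeaklyVertexChordal d Δ)
    ×
    ((∃[ n ] ∃[ d ] Σ[ Δ ∈ Complex n ] (1 ≤ d × HasDimension d Δ × Pure Δ ×
    MidChordal Δ × ¬ RidgeChordal d Δ))
    ×
    (∃[ n ] ∃[ d ] Σ[ Δ ∈ Complex n ] (1 ≤ d × HasDimension d Δ × Pure Δ ×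
    RidgeChordal d Δ × ¬ MidChordal Δ))
    ×
    (∃[ n ] ∃[ d ] Σ[ Δ ∈ Complex n ] (1 ≤ d × HasDimension d Δ × Pure Δ ×
    MidChordal Δ × ¬ VertexChordal d Δ)))
    ×
    (∃[ n ] ∃[ d ] Σ[ Δ ∈ Complex n ] (1 ≤ d × HasDimension d Δ × Pure Δ ×
    WeaklyRidgeChordal d Δ × ¬ VeryWeaklyChordal Δ))
    ×
    (∃[ n ] ∃[ d ] Σ[ Δ ∈ Complex n ] (1 ≤ d × HasDimension d Δ × Pure Δ ×
    WeaklyVertexChordal d Δ × ¬ MidChordal Δ))
theorem91 =
  veryWeaklyChordal⇒weaklyRidgeChordal ,
  midChordal⇒weaklyVertexChordal ,
  ((6 , 2 , generatedBy doubleCone , s≤s z≤n , cone-dim , cone-pure ,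
      doubleCone-midChordal , doubleCone-¬ridgeChordal) ,
   (5 , 2 , generatedBy mobius , s≤s z≤n , mobius-dim , mobius-pure ,
      mobius-ridgeChordal , mobius-¬midChordal) ,
   (6 , 2 , generatedBy doubleCone , s≤s z≤n , cone-dim , cone-pure ,
      doubleCone-midChordal , doubleCone-¬vertexChordal)) ,
  (5 , 2 , generatedBy mobius , s≤s z≤n , mobius-dim , mobius-pure ,
    mobius-weaklyRidgeChordal , mobius-¬veryWeaklyChordal) ,
  (5 , 2 , generatedBy mobius , s≤s z≤n , mobius-dim , mobius-pure ,
    mobius-weaklyVertexChordal , mobius-¬midChordal)
  where
  cone-dim    = generated-hasDimension doubleCone-uniform
  cone-pure   = generated-pure doubleCone-uniform
  mobius-dim  = generated-hasDimension mobius-uniform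
  mobius-pure = generated-pure mobius-uniform
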